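{- Suppose $E$ is a computably enumerable equivalence relation on $\mathbb{N}$ all of whose equivalence classes are infinite. Then $E$ is computably graphable by a computable graph of diameter $2$.
   Context: A ceer $E$ is computably graphable if there is a computable (undirected, simple) graph $G$ on $\mathbb{N}$ whose connectedness relation ($x,y$ related iff joined by a finite path in $G$) equals $E$. The diameter of a graph is the maximum distance between two connected vertices. -}

module Defs where

open import Data.Nat using (ℕ; zero; suc; _≤_)
open import Data.Bool using (Bool; true; false)
open import Data.Product using (Σ; ∃; _×_; _,_)
open import Relation.Binary.PropositionalEquality using (_≡_)
open import Relation.Binary.Structures using (IsEquivalence)
open import Relation.Nullary using (¬_)
open import Function.Bundles using (_⇔_)

-- Synthetic computability: every Agda function ℕ → … is computable
-- (we work under --safe, so there are no non-computable postulates).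

Rel₀ : Set₁
Rel₀ = ℕ → ℕ → Set

-- E is computably enumerable: there is a computable (decidable) stage-wise
-- approximation f with  E x y  iff  f s x y ≡ true for some stage s.
IsCE : Rel₀ → Set
IsCE E = Σ (ℕ → ℕ → ℕ → Bool) λ f → ∀ x y → E x y ⇔ (∃ λ s → f s x y ≡ true)

IsCeer : Rel₀ → Set
IsCeer E = IsEquivalence E × IsCE E

-- Every equivalence class is infinite: each class is unbounded in ℕ.
AllClassesInfinite : Rel₀ → Set
AllClassesInfinite E = ∀ x n → ∃ λ y → n ≤ y × E x y

-- A computable graph on ℕ is given by its computable edge predicate.
Graph : Set
Graph = ℕ → ℕ → Bool

Adj : Graph → ℕ → ℕ → Set
Adj G x y = G x y ≡ true

IsSimpleGraph : Graph → Set
IsSimpleGraph G = (∀ x y → G x y ≡ G y x) × (∀ x → ¬ Adj G x x)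

data Walk (G : Graph) : ℕ → ℕ → ℕ → Set where
  here  : ∀ {x} → Walk G zero x x
  step  : ∀ {n x y z} → Adj G x y → Walk G n y z → Walk G (suc n) x z

Connected : Graph → ℕ → ℕ → Set
Connected G x y = ∃ λ n → Walk G n x y

DistLe : Graph → ℕ → ℕ → ℕ → Set
DistLe G x y d = ∃ λ n → n ≤ d × Walk G n x y

Graphs : Graph → Rel₀ → Set
Graphs G E = ∀ x y → E x y ⇔ Connected G x y

HasDiameter2 : Graph → Set
HasDiameter2 G =
  (∀ x y → Connected G x y → DistLe G x y 2) ×
  (∃ λ x → ∃ λ y → Connected G x y × ¬ DistLe G x y 1)

module Submission where

-- For each enumerated
-- triple (x, y, s) join x and y to a fresh hub: a member of the class of x
-- larger than x, y, s (so the edge relation is decidable by a bounded search)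
-- and larger than a fixed second member w of the class of 0.  Every edge lies
-- inside an E-class and every E-pair is joined through its hub, so E is the
-- connectedness relation and all distances are at most 2; as every edge has an
-- endpoint above w, the vertices 0 and w are at distance exactly 2.

open import Defs
open import Data.Bool using (Bool; true)
open import Data.Bool.Properties using (∨-comm) renaming (_≟_ to _≟ᵇ_)
open import Data.Nat using (ℕ; zero; suc; _⊔_; _≤_; _<_; z≤n; s≤s; _≟_; anyUpTo?)
open import Data.Nat.Properties using (≤-refl; <-irrefl; <⇒≱; m⊔n<o⇒m<o; m⊔n<o⇒n<o)
open import Data.Product using (Σ; ∃; _×_; _,_; proj₁; proj₂)
open import Data.Sum using (_⊎_; inj₁; inj₂; [_,_])
open import Function.Bundles using (_⇔_; mk⇔; Equivalence)
open import Relation.Binary.PropositionalEquality using (_≡_; _≢_; refl; sym; trans; subst)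
open import Relation.Binary.Structures using (IsEquivalence)
open import Relation.Nullary using (¬_; Dec; yes; no; does; map′; _×-dec_; _⊎-dec_)
open import Relation.Nullary.Decidable using (dec-true)

does-true⇒ : {A : Set} (a? : Dec A) → does a? ≡ true → A
does-true⇒ (yes a) _ = a
does-true⇒ (no _) ()

module _ {G : Graph} where

  walk-length0⇒≡ : ∀ {a b} → Walk G 0 a b → a ≡ b
  walk-length0⇒≡ here = refl

  walk⇒related : {R : Rel₀} → IsEquivalence R → (∀ {a b} → Adj G a b → R a b) →
                 ∀ {n a b} → Walk G n a b → R a b
  walk⇒related isEq adj⇒R here = IsEquivalence.refl isEq
  walk⇒related isEq adj⇒R (step adj walk) =
    IsEquivalence.trans isEq (adj⇒R adj) (walk⇒related isEq adj⇒R walk)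

  ¬adj⇒¬distLe1 : ∀ {a b} → a ≢ b → ¬ Adj G a b → ¬ DistLe G a b 1
  ¬adj⇒¬distLe1 a≢b ¬adj (zero , _ , walk) = a≢b (walk-length0⇒≡ walk)
  ¬adj⇒¬distLe1 a≢b ¬adj (suc zero , _ , step adj walk) =
    ¬adj (subst (Adj G _) (walk-length0⇒≡ walk) adj)
  ¬adj⇒¬distLe1 a≢b ¬adj (suc (suc _) , s≤s () , _)

module HubGraph (f : ℕ → ℕ → ℕ → Bool) (w : ℕ) (hub : ℕ → ℕ → ℕ → ℕ)
                (hub-large : ∀ x y s → x ⊔ y ⊔ s ⊔ w < hub x y s) where

  x<hub : ∀ x y s → x < hub x y s
  x<hub x y s = m⊔n<o⇒m<o x y (m⊔n<o⇒m<o _ s (m⊔n<o⇒m<o _ w (hub-large x y s)))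

  y<hub : ∀ x y s → y < hub x y s
  y<hub x y s = m⊔n<o⇒n<o x y (m⊔n<o⇒m<o _ s (m⊔n<o⇒m<o _ w (hub-large x y s)))

  s<hub : ∀ x y s → s < hub x y s
  s<hub x y s = m⊔n<o⇒n<o _ s (m⊔n<o⇒m<o _ w (hub-large x y s))

  w<hub : ∀ x y s → w < hub x y s
  w<hub x y s = m⊔n<o⇒n<o _ w (hub-large x y s)

  -- The edges of G are the spokes b — a from a hub b to an endpoint a of one of its requests.
  Serves : ℕ → ℕ → ℕ → ℕ → ℕ → Set
  Serves b a x y s = f s x y ≡ true × hub x y s ≡ b × (a ≡ x ⊎ a ≡ y)

  Spoke : ℕ → ℕ → Set
  Spoke b a = ∃ λ x → ∃ λ y → ∃ λ s → Serves b a x y s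

  spoke? : ∀ b a → Dec (Spoke b a)
  spoke? b a = map′ unbounded bounded
    (anyUpTo? (λ x → anyUpTo? (λ y → anyUpTo? (λ s → serves? x y s) b) b) b)
    where
    serves? : ∀ x y s → Dec (Serves b a x y s)
    serves? x y s = (f s x y ≟ᵇ true) ×-dec (hub x y s ≟ b) ×-dec (a ≟ x ⊎-dec a ≟ y)

    unbounded : (∃ λ x → x < b × ∃ λ y → y < b × ∃ λ s → s < b × Serves b a x y s) →
                Spoke b a
    unbounded (x , _ , y , _ , s , _ , σ) = x , y , s , σ

    bounded : Spoke b a →
              ∃ λ x → x < b × ∃ λ y → y < b × ∃ λ s → s < b × Serves b a x y s
    bounded (x , y , s , σ@(_ , refl , _)) =
      x , x<hub x y s , y , y<hub x y s , s , s<hub x y s , σ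

  G : Graph
  G a b = does (spoke? a b ⊎-dec spoke? b a)

  adj⇒spoke : ∀ {a b} → Adj G a b → Spoke a b ⊎ Spoke b a
  adj⇒spoke {a} {b} = does-true⇒ (spoke? a b ⊎-dec spoke? b a)

  spoke⇒adj : ∀ {a b} → Spoke a b ⊎ Spoke b a → Adj G a b
  spoke⇒adj {a} {b} = dec-true (spoke? a b ⊎-dec spoke? b a)

  ¬spoke-loop : ∀ a → ¬ Spoke a a
  ¬spoke-loop _ (x , y , s , _ , hub≡a , inj₁ a≡x) = <-irrefl (sym (trans hub≡a a≡x)) (x<hub x y s)
  ¬spoke-loop _ (x , y , s , _ , hub≡a , inj₂ a≡y) = <-irrefl (sym (trans hub≡a a≡y)) (y<hub x y s)

  G-simple : IsSimpleGraph G
  G-simple = (λ a b → ∨-comm (does (spoke? a b)) (does (spoke? b a)))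
           , λ a adj → [ ¬spoke-loop a , ¬spoke-loop a ] (adj⇒spoke adj)

  spoke-above : ∀ {b a} → Spoke b a → w < b
  spoke-above (x , y , s , _ , refl , _) = w<hub x y s

  ¬adj-below : ∀ {a b} → a ≤ w → b ≤ w → ¬ Adj G a b
  ¬adj-below a≤w b≤w adj with adj⇒spoke adj
  ... | inj₁ spoke = <⇒≱ (spoke-above spoke) a≤w
  ... | inj₂ spoke = <⇒≱ (spoke-above spoke) b≤w

  enumerated⇒walk2 : ∀ {x y s} → f s x y ≡ true → Walk G 2 x y
  enumerated⇒walk2 {x} {y} {s} fsxy =
    step (spoke⇒adj (inj₂ (x , y , s , fsxy , refl , inj₁ refl)))
      (step (spoke⇒adj (inj₁ (x , y , s , fsxy , refl , inj₂ refl))) here)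

  module Related {E : Rel₀} (isEq : IsEquivalence E)
           (enum : ∀ x y → E x y ⇔ (∃ λ s → f s x y ≡ true))
           (hub-related : ∀ x y s → E x (hub x y s)) where
    open IsEquivalence isEq renaming (sym to E-sym; trans to E-trans)

    spoke⇒related : ∀ {b a} → Spoke b a → E a b
    spoke⇒related (x , y , s , _ , refl , inj₁ refl) = hub-related x y s
    spoke⇒related (x , y , s , fsxy , refl , inj₂ refl) =
      E-trans (E-sym (Equivalence.from (enum x y) (s , fsxy))) (hub-related x y s)

    adj⇒related : ∀ {a b} → Adj G a b → E a b
    adj⇒related adj with adj⇒spoke adj
    ... | inj₁ spoke = E-sym (spoke⇒related spoke)
    ... | inj₂ spoke = spoke⇒related spoke

    related⇒walk2 : ∀ {x y} → E x y → Walk G 2 x y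
    related⇒walk2 {x} {y} xEy = enumerated⇒walk2 (proj₂ (Equivalence.to (enum x y) xEy))

theorem7p2 : (E : Rel₀) → IsCeer E → AllClassesInfinite E →
    Σ Graph (λ G → IsSimpleGraph G × Graphs G E × HasDiameter2 G)
theorem7p2 E (isEq , f , enum) infinite =
  G , G-simple , graphs , (diameter≤2 , 0 , w , (2 , related⇒walk2 0Ew) , ¬distLe1)
  where
  w : ℕ
  w = proj₁ (infinite 0 1)

  0Ew : E 0 w
  0Ew = proj₂ (proj₂ (infinite 0 1))

  hub : ℕ → ℕ → ℕ → ℕ
  hub x y s = proj₁ (infinite x (suc (x ⊔ y ⊔ s ⊔ w)))

  open HubGraph f w hub (λ x y s → proj₁ (proj₂ (infinite x _)))
  open Related isEq enum (λ x y s → proj₂ (proj₂ (infinite x _)))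

  connected⇒related : ∀ {a b} → Connected G a b → E a b
  connected⇒related (_ , walk) = walk⇒related isEq adj⇒related walk

  graphs : Graphs G E
  graphs a b = mk⇔ (λ aEb → 2 , related⇒walk2 aEb) connected⇒related

  diameter≤2 : ∀ a b → Connected G a b → DistLe G a b 2
  diameter≤2 a b conn = 2 , ≤-refl , related⇒walk2 (connected⇒related conn)

  ¬distLe1 : ¬ DistLe G 0 w 1
  ¬distLe1 = ¬adj⇒¬distLe1 (λ 0≡w → <-irrefl 0≡w 0<w) (¬adj-below z≤n ≤-refl)
    where
    0<w : 0 < w
    0<w = proj₁ (proj₂ (infinite 0 1))
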